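{- For every non-negative integer $n$, the map $(T,\lambda)\mapsto\sigma(T,\lambda)$ is a bijection from the set of all increasing trees with $n$ branchings onto the set of all set compositions of $[n]=\{1,\ldots,n\}$.
   Context: A (planar rooted) tree is a finite planar rooted tree in which every vertex has exactly one outgoing edge (towards the root; the vertex nearest the root has an outgoing root edge) and at least two incoming edges, ordered from left to right; incoming edges either come from another vertex or are leaves. The trivial tree $\varepsilon$ has no vertex (a single edge). For $m\ge 1$ and trees $T_0,\ldots,T_m$, the wedge $\bigvee(T_0,\ldots,T_m)$ is obtained by joining the roots of $T_0,\ldots,T_m$ (in this left-to-right order) to a new vertex, which receives a new root edge; every non-trivial tree is uniquely such a wedge. A vertex with $m+1$ incoming edges carries $m$ branchings, namely the $m$ pairs of consecutive incoming edges at that vertex; a branching is assigned the vertex carrying it. Let $B(T)$ be the set of branchings of $T$ and $b(T)=|B(T)|$. The left-to-right order $\preceq$ on $B(T)$ is defined recursively: if $T=\bigvee(T_0,\ldots,T_m)$ and $b_1,\ldots,b_m$ are the branchings at the root vertex, from left to right (the root branchings, $b_i$ lying between $T_{i-1}$ and $T_i$), then $b_i\prec b\prec b_{i+1}$ for all $b\in B(T_i)$ (with $b_0$, $b_{m+1}$ omitted), and $B(T_i)$ carries its own order. The natural labelling is the unique order-preserving bijection $([n],\le)\to(B(T),\preceq)$, $n=b(T)$. A standard level function on $T$ is a surjective map $\lambda$ from the set of vertices of $T$ onto $[k]$ for some $k\ge 0$ that is strictly increasing along every path from a leaf to the root; an increasing tree is a pair $(T,\lambda)$ with $\lambda$ a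 standard level function, and the level of a branching is the level of its vertex. A set composition of a finite set $S$ of length $k$ is a tuple $(P_1,\ldots,P_k)$ of pairwise disjoint non-empty subsets with union $S$. For an increasing tree $(T,\lambda)$ with $n$ branchings and $k$ levels, $\sigma(T,\lambda)=(P_1,\ldots,P_k)$ where $P_i$ is the set of natural labels of the branchings of $T$ at level $i$. -}

module Defs where

open import Data.Fin as Fin using (Fin; zero; suc; toℕ; cast)
import Data.Fin.Properties as Fin
open import Data.Fin.Subset using (Subset; _∈_; _∩_; ⋃; ⊤; Nonempty; Empty)
open import Data.Fin.Subset.Properties using (x∈p∩q⁻; x∈p∪q⁺; ∈⊤; ⊆⊤; ⊆-antisym)
open import Data.List as List using (List; []; _∷_; _++_; map; concat; length)
open import Data.List.Membership.Propositional using () renaming (_∈_ to _∈ˡ_)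
open import Data.List.Membership.Propositional.Properties
  using (∈-map⁺; ∈-++⁺ˡ; ∈-++⁺ʳ; ∈-concat⁺′; ∈-tabulate⁺; ∈-lookup)
open import Data.List.Relation.Unary.All as All using (All; []; _∷_)
import Data.List.Relation.Unary.All.Properties as All
open import Data.List.Relation.Unary.AllPairs as AllPairs using (AllPairs; []; _∷_)
import Data.List.Relation.Unary.AllPairs.Properties as AllPairs
import Data.List.Relation.Unary.Any as Any
open import Data.List.Relation.Unary.Any.Properties using (lookup-index)
open import Data.Nat as ℕ using (ℕ; zero; suc; z≤n; s≤s)
import Data.Nat.Properties as ℕ
open import Data.Product using (Σ; _,_; ∃)
open import Data.Sum using (inj₁; inj₂)
open import Data.Vec as Vec using (Vec; []; _∷_; lookup; tabulate; toList)
open import Data.Vec.Properties using (lookup∘tabulate; lookup⇒[]=; []=⇒lookup)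
open import Function using (_∘_)
open import Function.Definitions using (Surjective)
open import Relation.Binary using (tri<; tri≈; tri>)
open import Relation.Binary.Construct.Closure.Reflexive using (ReflClosure; refl; [_])
open import Relation.Binary.Morphism.Structures using (IsOrderIsomorphism)
open import Relation.Binary.PropositionalEquality
  using (_≡_; _≢_; refl; sym; trans; cong; subst)
open import Relation.Nullary using (¬_; yes; no; does; contradiction)
open import Relation.Nullary.Decidable using (dec-true)

------------------------------------------------------------------------
-- Planar rooted trees

-- A vertex has at least two incoming edges: ⋁ (T₀ ∷ … ∷ Tₘ₊₁ ∷ []) is
-- the wedge of m + 2 trees, and its root vertex carries m + 1 branchings.
data Tree : Set where
  ε : Tree
  ⋁ : ∀ {m} → Vec Tree (suc (suc m)) → Tree

data Leaf : Tree → Set where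
  edge : Leaf ε
  sub  : ∀ {m} {Ts : Vec Tree (suc (suc m))} i → Leaf (lookup Ts i) → Leaf (⋁ Ts)

data Vertex : Tree → Set where
  root : ∀ {m} {Ts : Vec Tree (suc (suc m))} → Vertex (⋁ Ts)
  sub  : ∀ {m} {Ts : Vec Tree (suc (suc m))} i → Vertex (lookup Ts i) → Vertex (⋁ Ts)

-- The vertices met on the way from a leaf to the root, in this order.
path : ∀ {T} → Leaf T → List (Vertex T)
path edge      = []
path (sub i ℓ) = map (sub i) (path ℓ) ++ root ∷ []

------------------------------------------------------------------------
-- Branchings

-- root i is the root branching between the i-th and (i + 1)-st subtrees,
-- where subtrees are numbered from 0.
data Branching : Tree → Set where
  root : ∀ {m} {Ts : Vec Tree (suc (suc m))} → Fin (suc m) → Branching (⋁ Ts)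
  sub  : ∀ {m} {Ts : Vec Tree (suc (suc m))} i → Branching (lookup Ts i) → Branching (⋁ Ts)

vertexOf : ∀ {T} → Branching T → Vertex T
vertexOf (root _)  = root
vertexOf (sub i b) = sub i (vertexOf b)

-- The left-to-right order.  All consequences by transitivity of
-- "root branchings separate the subtrees" are listed outright.
infix 4 _≺_ _≼_

data _≺_ : ∀ {T} → Branching T → Branching T → Set where
  root-root : ∀ {m} {Ts : Vec Tree (suc (suc m))} {i j : Fin (suc m)} →
              i Fin.< j → root {Ts = Ts} i ≺ root j
  root-sub  : ∀ {m} {Ts : Vec Tree (suc (suc m))} {i : Fin (suc m)} {j} {c : Branching (lookup Ts j)} →
              toℕ i ℕ.< toℕ j → root {Ts = Ts} i ≺ sub j c
  sub-root  : ∀ {m} {Ts : Vec Tree (suc (suc m))} {i} {j : Fin (suc m)} {b : Branching (lookup Ts i)} →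
              toℕ i ℕ.≤ toℕ j → sub {Ts = Ts} i b ≺ root j
  sub-sub   : ∀ {m} {Ts : Vec Tree (suc (suc m))} {i j}
              {b : Branching (lookup Ts i)} {c : Branching (lookup Ts j)} →
              i Fin.< j → sub {Ts = Ts} i b ≺ sub j c
  within    : ∀ {m} {Ts : Vec Tree (suc (suc m))} {i} {b c : Branching (lookup Ts i)} →
              b ≺ c → sub {Ts = Ts} i b ≺ sub i c

_≼_ : ∀ {T} → Branching T → Branching T → Set
_≼_ = ReflClosure _≺_

≺-asym : ∀ {T} {b c : Branching T} → b ≺ c → ¬ c ≺ b
≺-asym (root-root p) (root-root q) = ℕ.<-asym p q
≺-asym (root-sub p)  (sub-root q)  = ℕ.<⇒≱ p q
≺-asym (sub-root p)  (root-sub q)  = ℕ.<⇒≱ q p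
≺-asym (sub-sub p)   (sub-sub q)   = ℕ.<-asym p q
≺-asym (sub-sub p)   (within q)    = ℕ.<-irrefl refl p
≺-asym (within p)    (sub-sub q)   = ℕ.<-irrefl refl q
≺-asym (within p)    (within q)    = ≺-asym p q

------------------------------------------------------------------------
-- The natural labelling

branchings   : ∀ T → List (Branching T)
branchingsIn : ∀ {k} (Ts : Vec Tree k) i → List (Branching (lookup Ts i))

rootThenSub : ∀ {m} (Ts : Vec Tree (suc (suc m))) → Fin (suc m) → List (Branching (⋁ Ts))
rootThenSub Ts i = root i ∷ map (sub (suc i)) (branchingsIn Ts (suc i))

branchings ε      = []
branchings (⋁ Ts) = map (sub zero) (branchingsIn Ts zero)
                    ++ concat (List.tabulate (rootThenSub Ts))

branchingsIn (T ∷ Ts) zero    = branchings T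
branchingsIn (T ∷ Ts) (suc i) = branchingsIn Ts i

-- This is the number of elements of Branching T because naturalLabelling
-- is bijective, as shown below.
b : Tree → ℕ
b T = length (branchings T)

naturalLabelling : ∀ T → Fin (b T) → Branching T
naturalLabelling T = List.lookup (branchings T)

branchings-sorted   : ∀ T → AllPairs _≺_ (branchings T)
branchingsIn-sorted : ∀ {k} (Ts : Vec Tree k) i → AllPairs _≺_ (branchingsIn Ts i)

branchings-sorted ε      = []
branchings-sorted (⋁ Ts) =
  AllPairs.++⁺ (subs-sorted zero)
    (AllPairs.concat⁺
      (All.tabulate⁺ {f = rootThenSub Ts} λ i →
        all-subs (suc i) (λ _ → root-sub ℕ.≤-refl) ∷ subs-sorted (suc i))
      (AllPairs.tabulate⁺-< {f = rootThenSub Ts} λ {i} {j} i<j →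
        (root-root i<j ∷ all-subs (suc j) (λ _ → root-sub (ℕ.m<n⇒m<1+n i<j)))
        ∷ all-subs (suc i) (λ _ →
            sub-root i<j ∷ all-subs (suc j) (λ _ → sub-sub (s≤s i<j)))))
    (all-subs zero λ _ → All.concat⁺ (All.tabulate⁺ {f = rootThenSub Ts} λ i →
      sub-root z≤n ∷ all-subs (suc i) (λ _ → sub-sub (s≤s z≤n))))
  where
  subs : ∀ i → List (Branching (⋁ Ts))
  subs i = map (sub i) (branchingsIn Ts i)

  all-subs : ∀ {P : Branching (⋁ Ts) → Set} i → (∀ c → P (sub i c)) → All P (subs i)
  all-subs i p = All.map⁺ (All.universal p (branchingsIn Ts i))

  subs-sorted : ∀ i → AllPairs _≺_ (subs i)
  subs-sorted i = AllPairs.map⁺ (AllPairs.map within (branchingsIn-sorted Ts i))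

branchingsIn-sorted (T ∷ Ts) zero    = branchings-sorted T
branchingsIn-sorted (T ∷ Ts) (suc i) = branchingsIn-sorted Ts i

branchings-complete   : ∀ T (c : Branching T) → c ∈ˡ branchings T
branchingsIn-complete : ∀ {k} (Ts : Vec Tree k) i (c : Branching (lookup Ts i)) →
                        c ∈ˡ branchingsIn Ts i

branchings-complete (⋁ Ts) (root i) =
  ∈-++⁺ʳ (map (sub zero) (branchingsIn Ts zero))
    (∈-concat⁺′ (Any.here refl) (∈-tabulate⁺ {f = rootThenSub Ts} i))
branchings-complete (⋁ Ts) (sub zero c) =
  ∈-++⁺ˡ (∈-map⁺ (sub zero) (branchingsIn-complete Ts zero c))
branchings-complete (⋁ Ts) (sub (suc i) c) =
  ∈-++⁺ʳ (map (sub zero) (branchingsIn Ts zero))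
    (∈-concat⁺′ (Any.there (∈-map⁺ (sub (suc i)) (branchingsIn-complete Ts (suc i) c)))
                (∈-tabulate⁺ {f = rootThenSub Ts} i))

branchingsIn-complete (T ∷ Ts) zero    c = branchings-complete T c
branchingsIn-complete (T ∷ Ts) (suc i) c = branchingsIn-complete Ts i c

AllPairs-lookup : ∀ {A : Set} {R : A → A → Set} {xs} → AllPairs R xs →
                  ∀ {i j} → i Fin.< j → R (List.lookup xs i) (List.lookup xs j)
AllPairs-lookup {xs = _ ∷ xs} (px ∷ _) {zero} {suc j} _ = All.lookup px (∈-lookup {xs = xs} j)
AllPairs-lookup (_ ∷ pxs) {suc i} {suc j} (s≤s i<j)     = AllPairs-lookup pxs i<j

naturalLabelling-< : ∀ T {i j} → i Fin.< j → naturalLabelling T i ≺ naturalLabelling T j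
naturalLabelling-< T = AllPairs-lookup (branchings-sorted T)

naturalLabelling-surjective : ∀ T → Surjective _≡_ _≡_ (naturalLabelling T)
naturalLabelling-surjective T c =
  Any.index c∈ , λ { refl → sym (lookup-index c∈) }
  where c∈ = branchings-complete T c

naturalLabelling-isOrderIsomorphism :
  ∀ T → IsOrderIsomorphism _≡_ _≡_ Fin._≤_ _≼_ (naturalLabelling T)
naturalLabelling-isOrderIsomorphism T = record
  { isOrderMonomorphism = record
    { isOrderHomomorphism = record { cong = cong ν ; mono = mono }
    ; injective           = injective
    ; cancel              = cancel
    }
  ; surjective = naturalLabelling-surjective T
  }
  where
  ν = naturalLabelling T

  ≺-irrefl : ∀ {c d : Branching T} → c ≡ d → ¬ c ≺ d
  ≺-irrefl refl c≺c = ≺-asym c≺c c≺c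

  mono : ∀ {i j} → i Fin.≤ j → ν i ≼ ν j
  mono {i} {j} i≤j with Fin.<-cmp i j
  ... | tri< i<j _ _  = [ naturalLabelling-< T i<j ]
  ... | tri≈ _ refl _ = refl
  ... | tri> _ _ j<i  = contradiction i≤j (ℕ.<⇒≱ j<i)

  injective : ∀ {i j} → ν i ≡ ν j → i ≡ j
  injective {i} {j} eq with Fin.<-cmp i j
  ... | tri< i<j _ _ = contradiction (naturalLabelling-< T i<j) (≺-irrefl eq)
  ... | tri≈ _ i≡j _ = i≡j
  ... | tri> _ _ j<i = contradiction (naturalLabelling-< T j<i) (≺-irrefl (sym eq))

  ≺⇒⋡ : ∀ {c d : Branching T} → c ≺ d → ¬ d ≼ c
  ≺⇒⋡ c≺d [ d≺c ] = ≺-asym c≺d d≺c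
  ≺⇒⋡ c≺d refl    = ≺-asym c≺d c≺d

  cancel : ∀ {i j} → ν i ≼ ν j → i Fin.≤ j
  cancel i≼j = ℕ.≮⇒≥ λ j<i → ≺⇒⋡ (naturalLabelling-< T j<i) i≼j

------------------------------------------------------------------------
-- Increasing trees

-- The level set {1, …, k} is represented by Fin k.
record IsStandardLevelFunction {T k} (level : Vertex T → Fin k) : Set where
  field
    surjective : Surjective _≡_ _≡_ level
    increasing : ∀ (ℓ : Leaf T) → AllPairs (λ v w → level v Fin.< level w) (path ℓ)

record IncreasingTree (n : ℕ) : Set where
  field
    tree       : Tree
    b≡n        : b tree ≡ n
    height     : ℕ
    level      : Vertex tree → Fin height
    isStandard : IsStandardLevelFunction level

  open IsStandardLevelFunction isStandard public

  branching : Fin n → Branching tree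
  branching j = naturalLabelling tree (cast (sym b≡n) j)

  branchingLevel : Fin n → Fin height
  branchingLevel j = level (vertexOf (branching j))

-- Equality of increasing trees as pairs (T , λ): equal trees and
-- pointwise equal level functions with the same codomain.
infix 4 _≈_

record _≈_ {n} (A B : IncreasingTree n) : Set where
  private
    module A = IncreasingTree A
    module B = IncreasingTree B
  field
    tree-≡   : A.tree ≡ B.tree
    height-≡ : A.height ≡ B.height
    level-≡  : ∀ v → subst Fin height-≡ (A.level v) ≡ B.level (subst Vertex tree-≡ v)

------------------------------------------------------------------------
-- Set compositions

record SetComposition {n} (S : Subset n) : Set where
  field
    size     : ℕ
    blocks   : Vec (Subset n) size
    nonempty : ∀ i → Nonempty (lookup blocks i)
    disjoint : ∀ {i j} → i ≢ j → Empty (lookup blocks i ∩ lookup blocks j)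
    union    : ⋃ (toList blocks) ≡ S

  tuple : Σ ℕ (Vec (Subset n))
  tuple = size , blocks

-- Two set compositions are equal when their tuples are; the proof
-- components are ignored.
infix 4 _≋_

_≋_ : ∀ {n} {S : Subset n} → SetComposition S → SetComposition S → Set
P ≋ Q = SetComposition.tuple P ≡ SetComposition.tuple Q

------------------------------------------------------------------------
-- The map σ

∈-⋃⁺ : ∀ {n k} (ps : Vec (Subset n) k) i {x} → x ∈ lookup ps i → x ∈ ⋃ (toList ps)
∈-⋃⁺ (p ∷ ps) zero    x∈p = x∈p∪q⁺ (inj₁ x∈p)
∈-⋃⁺ (p ∷ ps) (suc i) x∈  = x∈p∪q⁺ (inj₂ (∈-⋃⁺ ps i x∈))

vertexOf-surjective : ∀ {T} (v : Vertex T) → ∃ λ c → vertexOf c ≡ v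
vertexOf-surjective root      = root zero , refl
vertexOf-surjective (sub i v) with c , refl ← vertexOf-surjective v = sub i c , refl

module _ {n} (A : IncreasingTree n) where
  open IncreasingTree A

  levelSet : Fin height → Subset n
  levelSet i = tabulate λ j → does (branchingLevel j Fin.≟ i)

  levelSets : Vec (Subset n) height
  levelSets = tabulate levelSet

  ∈-levelSet⁺ : ∀ i {j} → branchingLevel j ≡ i → j ∈ lookup levelSets i
  ∈-levelSet⁺ i {j} eq = subst (j ∈_) (sym (lookup∘tabulate levelSet i))
    (lookup⇒[]= j (levelSet i)
      (trans (lookup∘tabulate _ j) (dec-true (branchingLevel j Fin.≟ i) eq)))

  ∈-levelSet⁻ : ∀ i {j} → j ∈ lookup levelSets i → branchingLevel j ≡ i
  ∈-levelSet⁻ i {j} j∈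
    with branchingLevel j Fin.≟ i
       | trans (sym (lookup∘tabulate (λ j → does (branchingLevel j Fin.≟ i)) j))
               ([]=⇒lookup (subst (j ∈_) (lookup∘tabulate levelSet i) j∈))
  ... | yes eq | _  = eq
  ... | no _   | ()

  branching-surjective : ∀ c → ∃ λ j → branching j ≡ c
  branching-surjective c with i , ν≡c ← naturalLabelling-surjective tree c =
    cast b≡n i , ν≡c (Fin.cast-involutive (sym b≡n) b≡n i)

  levelSets-nonempty : ∀ i → Nonempty (lookup levelSets i)
  levelSets-nonempty i
    with v , level≡i ← surjective i
    with c , refl ← vertexOf-surjective v
    with j , refl ← branching-surjective c
    = j , ∈-levelSet⁺ i (level≡i refl)

  levelSets-disjoint : ∀ {i j} → i ≢ j → Empty (lookup levelSets i ∩ lookup levelSets j)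
  levelSets-disjoint {i} {j} i≢j (x , x∈)
    with x∈i , x∈j ← x∈p∩q⁻ (lookup levelSets i) (lookup levelSets j) x∈
    = i≢j (trans (sym (∈-levelSet⁻ i x∈i)) (∈-levelSet⁻ j x∈j))

  levelSets-union : ⋃ (toList levelSets) ≡ ⊤
  levelSets-union = ⊆-antisym ⊆⊤ λ {j} _ → ∈-⋃⁺ levelSets (branchingLevel j) (∈-levelSet⁺ _ refl)

  σ : SetComposition (⊤ {n})
  σ = record
    { size     = height
    ; blocks   = levelSets
    ; nonempty = levelSets-nonempty
    ; disjoint = levelSets-disjoint
    ; union    = levelSets-union
    }

{-# OPTIONS --safe #-}

-- Read the levels of the branchings of an increasing tree from left to right.
-- The level of the root vertex is the strict maximum of the resulting word, so
-- its occurrences cut the word into the words of the subtrees.  Hence the word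
-- determines the tree, and cutting any word at its largest letter rebuilds one.
-- A set composition (P₁ , … , Pₖ) of [n] is the same thing as the word whose
-- j-th letter is the index of the block containing j.

module Submission where

open import Defs
open import Data.Nat using (ℕ)
open import Function.Structures using (IsBijection)

open import Data.Fin as Fin using (Fin; zero; suc; toℕ; fromℕ<; cast)
import Data.Fin.Properties as Fin
open import Data.Fin.Subset using (Subset; ⊤; ⋃; _∈_)
open import Data.Fin.Subset.Properties using (x∈p∩q⁺; x∈p∪q⁻; ∈⊤; ∉⊥; ⊆-antisym)
open import Data.List using (List; []; _∷_; _++_; map; concat; length; tabulate)
import Data.List.Membership.Propositional as List
open import Data.List.Membership.Propositional.Properties
  using (∈-map⁺; ∈-map⁻; ∈-++⁺ˡ; ∈-++⁺ʳ; ∈-tabulate⁺)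
import Data.List.Properties as List
open import Data.List.Relation.Unary.All as All using (All; []; _∷_)
import Data.List.Relation.Unary.All.Properties as All
open import Data.List.Relation.Unary.AllPairs as AllPairs using (AllPairs; []; _∷_)
import Data.List.Relation.Unary.AllPairs.Properties as AllPairs
open import Data.List.Relation.Unary.Any using (here; there)
open import Data.Nat using (zero; suc; _≤_; _<_; s≤s⁻¹)
open import Data.Nat.Properties using (≤-refl; <⇒≤; <⇒≢; ≤-antisym; ≤∧≢⇒<; _≟_)
open import Data.Product using (Σ; ∃; _×_; _,_; proj₁; proj₂)
open import Data.Sum using (inj₁; inj₂)
open import Data.Vec as Vec using (Vec; []; _∷_; lookup; toList)
import Data.Vec.Functional as Functional
import Data.Vec.Properties as Vec
open import Function using (_∘_; Injective; Congruent)
open import Relation.Binary using (IsEquivalence)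
import Relation.Binary.Construct.On as On
open import Relation.Binary.PropositionalEquality
  using (_≡_; _≢_; _≗_; refl; sym; trans; cong; cong₂; subst; subst₂; isEquivalence;
         module ≡-Reasoning)
open import Relation.Nullary using (yes; no; contradiction)

-- Auxiliary facts about lists and vectors

lookup-ext : ∀ {A : Set} {n} {xs ys : Vec A n} → (∀ i → lookup xs i ≡ lookup ys i) → xs ≡ ys
lookup-ext {xs = xs} {ys} eq =
  trans (sym (Vec.tabulate∘lookup xs)) (trans (Vec.tabulate-cong eq) (Vec.tabulate∘lookup ys))

tabulate-injective : ∀ {A : Set} {n} {f g : Fin n → A} → tabulate f ≡ tabulate g → f ≗ g
tabulate-injective eq zero    = List.∷-injectiveˡ eq
tabulate-injective eq (suc i) = tabulate-injective (List.∷-injectiveʳ eq) i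

map-injective-∈ : ∀ {A B : Set} {f g : A → B} {xs} → map f xs ≡ map g xs →
                  ∀ {x} → x List.∈ xs → f x ≡ g x
map-injective-∈ {xs = _ ∷ _} eq (here refl) = List.∷-injectiveˡ eq
map-injective-∈ {xs = _ ∷ _} eq (there x∈)  = map-injective-∈ (List.∷-injectiveʳ eq) x∈

-- The `cast` matches the one in `branching`: this form turns the word of a tree into the list of
-- levels indexed by natural labels.
map≡tabulate : ∀ {A B : Set} {n} (f : A → B) xs (eq : length xs ≡ n) →
               map f xs ≡ tabulate (λ i → f (Data.List.lookup xs (cast (sym eq) i)))
map≡tabulate f xs refl = begin
  map f xs                                       ≡⟨ cong (map f) (List.tabulate-lookup xs) ⟨
  map f (tabulate (Data.List.lookup xs))         ≡⟨ List.map-tabulate _ f ⟩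
  tabulate (f ∘ Data.List.lookup xs)             ≡⟨ List.tabulate-cong (λ i →
      cong (f ∘ Data.List.lookup xs) (Fin.cast-is-id refl i)) ⟨
  tabulate (f ∘ Data.List.lookup xs ∘ cast refl) ∎
  where open ≡-Reasoning

AllPairs-∷ʳ⁻ : ∀ {A : Set} {R : A → A → Set} xs {x} → AllPairs R (xs ++ x ∷ []) →
               AllPairs R xs × All (λ y → R y x) xs
AllPairs-∷ʳ⁻ []       _         = [] , []
AllPairs-∷ʳ⁻ (y ∷ ys) (py ∷ ps) with qs , rs ← AllPairs-∷ʳ⁻ ys ps =
  All.++⁻ˡ ys py ∷ qs , All.head (All.++⁻ʳ ys py) ∷ rs

-- Words cut at a separator

module _ {A : Set} where

  -- Intercalation, shaped like `branchings`: every word but the first carries the separator in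
  -- front.
  join : ∀ {m} → A → (Fin (suc m) → List A) → List A
  join r f = f zero ++ concat (tabulate λ i → r ∷ f (suc i))

  join-cong : ∀ {m} r {f g : Fin (suc m) → List A} → f ≗ g → join r f ≡ join r g
  join-cong r eq =
    cong₂ _++_ (eq zero) (cong concat (List.tabulate-cong λ i → cong (r ∷_) (eq (suc i))))

  -- Each remainder is empty or starts with `r`, and neither prefix contains `r`, so both prefixes
  -- end at the first `r`, or at the end of the word.
  cut-unique : ∀ {r : A} {m m′} xs ys (f : Fin m → List A) (f′ : Fin m′ → List A) →
               All (_≢ r) xs → All (_≢ r) ys →
               xs ++ concat (tabulate λ i → r ∷ f i) ≡ ys ++ concat (tabulate λ i → r ∷ f′ i) →
               xs ≡ ys × concat (tabulate λ i → r ∷ f i) ≡ concat (tabulate λ i → r ∷ f′ i)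
  cut-unique [] [] f f′ _ _ eq = refl , eq
  cut-unique {m = suc _} [] (y ∷ ys) f f′ _ (y≢r ∷ _) eq =
    contradiction (sym (List.∷-injectiveˡ eq)) y≢r
  cut-unique {m′ = suc _} (x ∷ xs) [] f f′ (x≢r ∷ _) _ eq =
    contradiction (List.∷-injectiveˡ eq) x≢r
  cut-unique (x ∷ xs) (y ∷ ys) f f′ (_ ∷ xs≢r) (_ ∷ ys≢r) eq
    with refl , eq′ ← List.∷-injective eq
    with refl , eq″ ← cut-unique xs ys f f′ xs≢r ys≢r eq′
    = refl , eq″

  -- Induction on the number of words: `cut-unique` strips off the first one, and a non-empty
  -- remainder is `r` followed by a shorter join.
  join-injective : ∀ {r : A} {m m′} (f : Fin (suc m) → List A) (f′ : Fin (suc m′) → List A) →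
                   (∀ i → All (_≢ r) (f i)) → (∀ i → All (_≢ r) (f′ i)) →
                   join r f ≡ join r f′ →
                   ∃ λ (eq : m ≡ m′) → ∀ i → f i ≡ f′ (subst (Fin ∘ suc) eq i)
  join-injective {m = m} {m′} f f′ f≢r f′≢r eq
    with head≡ , rest≡ ← cut-unique (f zero) (f′ zero) (f ∘ suc) (f′ ∘ suc) (f≢r zero) (f′≢r zero) eq
    with m | m′
  -- Mixed cases cannot occur: an empty remainder differs from one that starts with `r`.
  ... | zero  | zero  = refl , λ { zero → head≡ }
  ... | suc _ | suc _
    with refl , tail≡ ← join-injective (f ∘ suc) (f′ ∘ suc) (f≢r ∘ suc) (f′≢r ∘ suc)
                          (List.∷-injectiveʳ rest≡)
    = refl , λ { zero → head≡ ; (suc i) → tail≡ i }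

-- Cuts at every occurrence of `k`, the largest letter allowed. Here `m` counts the occurrences and
-- may be zero.
split : ∀ k {w} → All (_< suc k) w →
        ∃ λ m → Σ (Fin (suc m) → List ℕ) λ f → (∀ i → All (_< k) (f i)) × w ≡ join k f
split k []        = 0 , (λ _ → []) , (λ _ → []) , refl
split k {x ∷ _} (x<1+k ∷ w<) with m , f , f< , refl ← split k w< | x ≟ k
-- A separator opens a new empty first piece; any other letter extends the current first piece.
... | yes refl = suc m , [] Functional.∷ f , (λ { zero → [] ; (suc i) → f< i }) , refl
... | no x≢k   = m , (x ∷ f zero) Functional.∷ (f ∘ suc)
               , (λ { zero → ≤∧≢⇒< (s≤s⁻¹ x<1+k) x≢k ∷ f< zero ; (suc i) → f< (suc i) })
               , refl

-- The word of a tree with levels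

-- Levels are arbitrary natural numbers here, because restricting a standard level function to a
-- subtree may skip values.
word : ∀ {T} → (Vertex T → ℕ) → List ℕ
word {T} g = map (g ∘ vertexOf) (branchings T)

Increasing : ∀ {T} → (Vertex T → ℕ) → Set
Increasing {T} g = ∀ (ℓ : Leaf T) → AllPairs (λ v w → g v < g w) (path ℓ)

branchingsIn≡ : ∀ {m} (Ts : Vec Tree m) i → branchingsIn Ts i ≡ branchings (lookup Ts i)
branchingsIn≡ (T ∷ Ts) zero    = refl
branchingsIn≡ (T ∷ Ts) (suc i) = branchingsIn≡ Ts i

word-⋁ : ∀ {m} {Ts : Vec Tree (suc (suc m))} (g : Vertex (⋁ Ts) → ℕ) →
         word g ≡ join (g root) (λ i → word (g ∘ sub i))
word-⋁ {m} {Ts} g = begin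
  map h (subs zero ++ concat (tabulate (rootThenSub Ts)))
    ≡⟨ List.map-++ h (subs zero) _ ⟩
  map h (subs zero) ++ map h (concat (tabulate (rootThenSub Ts)))
    ≡⟨ cong₂ _++_ (word-sub zero) (sym (List.concat-map (tabulate (rootThenSub Ts)))) ⟩
  word (g ∘ sub zero) ++ concat (map (map h) (tabulate (rootThenSub Ts)))
    ≡⟨ cong (λ wss → word (g ∘ sub zero) ++ concat wss)
         (trans (List.map-tabulate (rootThenSub Ts) (map h))
                (List.tabulate-cong λ i → cong (g root ∷_) (word-sub (suc i)))) ⟩
  join (g root) (λ i → word (g ∘ sub i)) ∎
  where
  open ≡-Reasoning
  h = g ∘ vertexOf

  subs : ∀ i → List (Branching (⋁ Ts))
  subs i = map (sub i) (branchingsIn Ts i)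

  word-sub : ∀ i → map h (subs i) ≡ word (g ∘ sub i)
  word-sub i = trans (sym (List.map-∘ (branchingsIn Ts i)))
                     (cong (map (h ∘ sub i)) (branchingsIn≡ Ts i))

∈-word⁺ : ∀ {T} (g : Vertex T → ℕ) v → g v List.∈ word g
∈-word⁺ {T} g v with c , refl ← vertexOf-surjective v = ∈-map⁺ (g ∘ vertexOf) (branchings-complete T c)

∈-word⁻ : ∀ {T} (g : Vertex T → ℕ) {x} → x List.∈ word g → ∃ λ v → x ≡ g v
∈-word⁻ g x∈ with c , _ , x≡ ← ∈-map⁻ (g ∘ vertexOf) x∈ = vertexOf c , x≡

leaf : ∀ T → Leaf T
leaf ε            = edge
leaf (⋁ (T ∷ Ts)) = sub zero (leaf T)

-- `Increasing` only speaks about paths from leaves, so comparing a vertex with the root needs a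
-- leaf above that vertex.
∈-path : ∀ {T} (v : Vertex T) → ∃ λ ℓ → v List.∈ path ℓ
∈-path {⋁ (T ∷ Ts)} root = sub zero (leaf T) , ∈-++⁺ʳ (map (sub zero) (path (leaf T))) (here refl)
∈-path (sub i v) with ℓ , v∈ ← ∈-path v = sub i ℓ , ∈-++⁺ˡ (∈-map⁺ (sub i) v∈)

module _ {m} {Ts : Vec Tree (suc (suc m))} {g : Vertex (⋁ Ts) → ℕ} where

  increasing-sub : Increasing g → ∀ i → Increasing (g ∘ sub i)
  increasing-sub inc i ℓ = AllPairs.map⁻ (proj₁ (AllPairs-∷ʳ⁻ (map (sub i) (path ℓ)) (inc (sub i ℓ))))

  sub<root : Increasing g → ∀ i v → g (sub i v) < g root
  sub<root inc i v with ℓ , v∈ ← ∈-path v =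
    All.lookup (proj₂ (AllPairs-∷ʳ⁻ (map (sub i) (path ℓ)) (inc (sub i ℓ)))) (∈-map⁺ (sub i) v∈)

  increasing-⋁ : (∀ i → Increasing (g ∘ sub i)) → (∀ i v → g (sub i v) < g root) → Increasing g
  increasing-⋁ inc <root (sub i ℓ) =
    AllPairs.++⁺ (AllPairs.map⁺ (inc i ℓ)) ([] ∷ [])
      (All.map⁺ (All.universal (λ v → <root i v ∷ []) (path ℓ)))

  ≤root : Increasing g → ∀ v → g v ≤ g root
  ≤root inc root      = ≤-refl
  ≤root inc (sub i v) = <⇒≤ (sub<root inc i v)

  word-sub≢root : Increasing g → ∀ i → All (_≢ g root) (word (g ∘ sub i))
  word-sub≢root inc i = All.map⁺ (All.universal (λ c → <⇒≢ (sub<root inc i (vertexOf c))) _)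

-- The letter `g root` occurs in the word of `g′`, all of whose letters are at most `g′ root`.
word≡⇒root≤ : ∀ {m m′} {Ts : Vec Tree (suc (suc m))} {Ts′ : Vec Tree (suc (suc m′))}
              {g : Vertex (⋁ Ts) → ℕ} {g′ : Vertex (⋁ Ts′) → ℕ} →
              Increasing g′ → word g ≡ word g′ → g root ≤ g′ root
word≡⇒root≤ {g = g} {g′} inc′ eq
  with v , g≡ ← ∈-word⁻ g′ (subst (g root List.∈_) eq (∈-word⁺ g root))
  = subst (_≤ g′ root) (sym g≡) (≤root inc′ v)

word≡⇒root≡ : ∀ {m m′} {Ts : Vec Tree (suc (suc m))} {Ts′ : Vec Tree (suc (suc m′))}
              {g : Vertex (⋁ Ts) → ℕ} {g′ : Vertex (⋁ Ts′) → ℕ} →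
              Increasing g → Increasing g′ → word g ≡ word g′ → g root ≡ g′ root
word≡⇒root≡ {g = g} {g′} inc inc′ eq =
  ≤-antisym (word≡⇒root≤ {g = g} {g′} inc′ eq) (word≡⇒root≤ {g = g′} {g} inc (sym eq))

-- Uniqueness of the tree with a given word

-- Equal words have equal maxima, hence equal root levels. Cutting there gives the same pieces on
-- both sides, and induction applies to the subtrees.
word≡⇒tree≡ : ∀ T T′ {g : Vertex T → ℕ} {g′ : Vertex T′ → ℕ} →
              Increasing g → Increasing g′ → word g ≡ word g′ → T ≡ T′
-- Walks along `Ts` to the subtree, which keeps the mutual recursion structural.
word≡⇒lookup≡ : ∀ {m} (Ts : Vec Tree m) i T′ {g : Vertex (lookup Ts i) → ℕ} {g′ : Vertex T′ → ℕ} →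
                Increasing g → Increasing g′ → word g ≡ word g′ → lookup Ts i ≡ T′

word≡⇒tree≡ ε ε _ _ _ = refl
word≡⇒tree≡ ε (⋁ _) {g′ = g′} _ _ eq with () ← subst (g′ root List.∈_) (sym eq) (∈-word⁺ g′ root)
word≡⇒tree≡ (⋁ _) ε {g} _ _ eq with () ← subst (g root List.∈_) eq (∈-word⁺ g root)
word≡⇒tree≡ (⋁ Ts) (⋁ Ts′) {g} {g′} inc inc′ eq
  with root≡ ← word≡⇒root≡ {g = g} {g′} inc inc′ eq
  with refl , words≡ ← join-injective (λ i → word (g ∘ sub i)) (λ i → word (g′ ∘ sub i))
         (word-sub≢root inc)
         (subst (λ r → ∀ i → All (_≢ r) (word (g′ ∘ sub i))) (sym root≡) (word-sub≢root inc′))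
         (trans (sym (word-⋁ g)) (trans eq (trans (word-⋁ g′)
           (cong (λ r → join r (λ i → word (g′ ∘ sub i))) (sym root≡)))))
  = cong ⋁ (lookup-ext λ i →
      word≡⇒lookup≡ Ts i (lookup Ts′ i) (increasing-sub inc i) (increasing-sub inc′ i) (words≡ i))

word≡⇒lookup≡ (T ∷ Ts) zero    = word≡⇒tree≡ T
word≡⇒lookup≡ (T ∷ Ts) (suc i) = word≡⇒lookup≡ Ts i

-- Every vertex carries a branching, so its level appears in the word at the position of that
-- branching.
word≡⇒levels≡ : ∀ {T T′} {g : Vertex T → ℕ} {g′ : Vertex T′ → ℕ} (eq : T ≡ T′) → word g ≡ word g′ →
                ∀ v → g v ≡ g′ (subst Vertex eq v)
word≡⇒levels≡ {T} refl eq v with c , refl ← vertexOf-surjective v =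
  map-injective-∈ eq (branchings-complete T c)

-- Existence of a tree with a given word

Realisation : List ℕ → Tree → Set
Realisation w T = Σ (Vertex T → ℕ) λ g → Increasing g × word g ≡ w

wedgeLevel : ∀ {m} {Ts : Vec Tree (suc (suc m))} →
             ℕ → (∀ i → Vertex (lookup Ts i) → ℕ) → Vertex (⋁ Ts) → ℕ
wedgeLevel r gs root      = r
wedgeLevel r gs (sub i v) = gs i v

-- Induction on the bound `k`. If the largest allowed letter occurs, it becomes the root level and
-- the pieces become the subtrees; otherwise the bound drops by one.
realise : ∀ k {w} → All (_< k) w → ∃ (Realisation w)
realise zero    [] = ε , (λ ()) , (λ { edge → [] }) , refl
realise (suc k) w< with split k w<
... | zero  , f , f< , refl =
  -- No cut was made, so the single piece is the whole word up to `++ []`.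
  subst (∃ ∘ Realisation) (sym (List.++-identityʳ (f zero))) (realise k (f< zero))
... | suc m , f , f< , refl =
  ⋁ Ts , wedgeLevel k gs
  , increasing-⋁ {g = wedgeLevel k gs} (λ i → proj₁ (proj₂ (subtree i)))
      (λ i v → All.lookup (f< i) (subst (gs i v List.∈_) (proj₂ (proj₂ (subtree i))) (∈-word⁺ (gs i) v)))
  , trans (word-⋁ (wedgeLevel k gs)) (join-cong k λ i → proj₂ (proj₂ (subtree i)))
  where
  Ts : Vec Tree (suc (suc m))
  Ts = Vec.tabulate λ i → proj₁ (realise k (f< i))

  subtree : ∀ i → Realisation (f i) (lookup Ts i)
  subtree i = subst (Realisation (f i))
    (sym (Vec.lookup∘tabulate (λ i → proj₁ (realise k (f< i))) i))
    (proj₂ (realise k (f< i)))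

  gs : ∀ i → Vertex (lookup Ts i) → ℕ
  gs i = proj₁ (subtree i)

-- Increasing trees and set compositions

open IncreasingTree

levelWord : ∀ {n} → IncreasingTree n → List ℕ
levelWord A = word (toℕ ∘ level A)

levelWord≡tabulate : ∀ {n} (A : IncreasingTree n) → levelWord A ≡ tabulate (toℕ ∘ branchingLevel A)
levelWord≡tabulate A = map≡tabulate (toℕ ∘ level A ∘ vertexOf) (branchings (tree A)) (b≡n A)

-- The levels of the realising tree are exactly the letters of its word: they lie below `k`, and
-- since `f` is onto, all of `Fin k` occurs.
fromLevels : ∀ {n k} (f : Fin n → Fin k) → (∀ i → ∃ λ j → f j ≡ i) →
             Σ (IncreasingTree n) λ A → Σ (height A ≡ k) λ eq →
             ∀ j → subst Fin eq (branchingLevel A j) ≡ f j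
fromLevels {n} {k} f onto
  with T , g , inc , word≡ ← realise k (All.tabulate⁺ {f = toℕ ∘ f} (Fin.toℕ<n ∘ f))
  = A , refl , λ j → Fin.toℕ-injective (tabulate-injective levels≡ j)
  where
  g< : ∀ v → g v < k
  g< v = All.lookup {P = _< k} (All.tabulate⁺ {f = toℕ ∘ f} (Fin.toℕ<n ∘ f))
                    (subst (g v List.∈_) word≡ (∈-word⁺ g v))

  toℕ-level : ∀ v → toℕ (fromℕ< (g< v)) ≡ g v
  toℕ-level v = Fin.toℕ-fromℕ< (g< v)

  level-surjective : ∀ i → ∃ λ v → fromℕ< (g< v) ≡ i
  level-surjective i
    with j , refl ← onto i
    with v , f≡g ← ∈-word⁻ g (subst (toℕ (f j) List.∈_) (sym word≡) (∈-tabulate⁺ {f = toℕ ∘ f} j))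
    = v , Fin.toℕ-injective (trans (toℕ-level v) (sym f≡g))

  A : IncreasingTree n
  A = record
    { tree       = T
    ; b≡n        = trans (sym (List.length-map (g ∘ vertexOf) (branchings T)))
                         (trans (cong length word≡) (List.length-tabulate (toℕ ∘ f)))
    ; height     = k
    ; level      = λ v → fromℕ< (g< v)
    ; isStandard = record
      { surjective = λ i → let v , eq = level-surjective i in v , λ { refl → eq }
      ; increasing = λ ℓ → AllPairs.map
          (λ {v} {w} → subst₂ _<_ (sym (toℕ-level v)) (sym (toℕ-level w))) (inc ℓ)
      }
    }

  levels≡ : tabulate (toℕ ∘ branchingLevel A) ≡ tabulate (toℕ ∘ f)
  levels≡ = trans (sym (levelWord≡tabulate A))
                  (trans (List.map-cong (toℕ-level ∘ vertexOf) (branchings T)) word≡)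

-- Blocks of a set composition and surjectivity of `σ`

∈-⋃⁻ : ∀ {n k} (ps : Vec (Subset n) k) {x} → x ∈ ⋃ (toList ps) → ∃ λ i → x ∈ lookup ps i
∈-⋃⁻ []       x∈ = contradiction x∈ ∉⊥
∈-⋃⁻ (p ∷ ps) x∈ with x∈p∪q⁻ p (⋃ (toList ps)) x∈
... | inj₁ x∈p = zero , x∈p
... | inj₂ x∈⋃ with i , x∈i ← ∈-⋃⁻ ps x∈⋃ = suc i , x∈i

module _ {n} {S : Subset n} (P : SetComposition S) where
  open SetComposition P

  block-unique : ∀ {i j x} → x ∈ lookup blocks i → x ∈ lookup blocks j → i ≡ j
  block-unique {i} {j} x∈i x∈j with i Fin.≟ j
  ... | yes i≡j = i≡j
  ... | no  i≢j = contradiction (_ , x∈p∩q⁺ (x∈i , x∈j)) (disjoint i≢j)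

-- The hypothesis puts each level set inside the corresponding block; disjointness of the blocks
-- gives the reverse inclusion.
σ-unique : ∀ {n} (A : IncreasingTree n) (P : SetComposition ⊤) (eq : height A ≡ SetComposition.size P) →
           (∀ j → j ∈ lookup (SetComposition.blocks P) (subst Fin eq (branchingLevel A j))) → σ A ≋ P
σ-unique A P@record { blocks = blocks } refl ∈block =
  cong (height A ,_) (lookup-ext λ i → ⊆-antisym
    (λ {j} j∈ → subst (λ i → j ∈ lookup blocks i) (∈-levelSet⁻ A i j∈) (∈block j))
    (λ {j} j∈ → ∈-levelSet⁺ A i (block-unique P (∈block j) j∈)))

σ-onto : ∀ {n} (P : SetComposition (⊤ {n})) → ∃ λ A → σ A ≋ P
σ-onto {n} P = A , σ-unique A P height≡ λ j →
  subst (λ i → j ∈ lookup blocks i) (sym (levels≡ j)) (∈-blockOf j)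
  where
  open SetComposition P

  blockOf : ∀ j → ∃ λ i → j ∈ lookup blocks i
  blockOf j = ∈-⋃⁻ blocks (subst (j ∈_) (sym union) ∈⊤)

  ∈-blockOf : ∀ j → j ∈ lookup blocks (proj₁ (blockOf j))
  ∈-blockOf j = proj₂ (blockOf j)

  -- Non-emptiness of the blocks makes the block index an onto function, as a standard level
  -- function requires.
  realisation = fromLevels (proj₁ ∘ blockOf) λ i →
    let j , j∈ = nonempty i in j , block-unique P (∈-blockOf j) j∈

  A : IncreasingTree n
  A = proj₁ realisation

  height≡ : height A ≡ size
  height≡ = proj₁ (proj₂ realisation)

  levels≡ : ∀ j → subst Fin height≡ (branchingLevel A j) ≡ proj₁ (blockOf j)
  levels≡ = proj₂ (proj₂ realisation)

-- Congruence and injectivity of `σ`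

branchingLevel-cong : ∀ {n} {A B : IncreasingTree n} (A≈B : A ≈ B) j →
                      subst Fin (_≈_.height-≡ A≈B) (branchingLevel A j) ≡ branchingLevel B j
branchingLevel-cong {A = record {}} {B = record {}}
  record { tree-≡ = refl ; height-≡ = refl ; level-≡ = level≡ } j = level≡ _

σ-cong : ∀ {n} → Congruent (_≈_ {n}) _≋_ σ
σ-cong {x = A} {y = B} A≈B = σ-unique A (σ B) (_≈_.height-≡ A≈B) λ j →
  ∈-levelSet⁺ B _ (sym (branchingLevel-cong A≈B j))

-- Block indices are compared in ℕ, so that equality of tuples can be used by
-- substitution although their sizes are not definitionally equal.
InBlock : ∀ {n} → ℕ → Fin n → Σ ℕ (Vec (Subset n)) → Set
InBlock x j (k , blocks) = Σ (Fin k) λ i → toℕ i ≡ x × j ∈ lookup blocks i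

σ≋⇒branchingLevel≡ : ∀ {n} (A B : IncreasingTree n) → σ A ≋ σ B →
                     ∀ j → toℕ (branchingLevel A j) ≡ toℕ (branchingLevel B j)
σ≋⇒branchingLevel≡ A B σA≋σB j
  with i , i≡ , j∈i ← subst (InBlock (toℕ (branchingLevel A j)) j) σA≋σB
                        (branchingLevel A j , refl , ∈-levelSet⁺ A _ refl)
  = trans (sym i≡) (cong toℕ (sym (∈-levelSet⁻ B i j∈i)))

toℕ-subst : ∀ {m n} (eq : m ≡ n) (i : Fin m) → toℕ (subst Fin eq i) ≡ toℕ i
toℕ-subst refl i = refl

-- The blocks determine the level of each label, hence the word, which determines the tree and its
-- levels; the height is the number of blocks.
σ-injective : ∀ {n} → Injective (_≈_ {n}) _≋_ σ
σ-injective {x = A} {y = B} σA≋σB = record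
  { tree-≡   = tree≡
  ; height-≡ = height≡
  ; level-≡  = λ v → Fin.toℕ-injective
      (trans (toℕ-subst height≡ (level A v)) (word≡⇒levels≡ {g′ = toℕ ∘ level B} tree≡ word≡ v))
  }
  where
  word≡ : levelWord A ≡ levelWord B
  word≡ = trans (levelWord≡tabulate A)
    (trans (List.tabulate-cong (σ≋⇒branchingLevel≡ A B σA≋σB)) (sym (levelWord≡tabulate B)))

  tree≡ : tree A ≡ tree B
  tree≡ = word≡⇒tree≡ (tree A) (tree B) (increasing A) (increasing B) word≡

  height≡ : height A ≡ height B
  height≡ = cong proj₁ σA≋σB

-- Bijectivity of `σ`

≈-isEquivalence : ∀ {n} → IsEquivalence (_≈_ {n})
≈-isEquivalence = record { refl = ≈-refl ; sym = ≈-sym ; trans = ≈-trans }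
  where
  ≈-refl : ∀ {n} {A : IncreasingTree n} → A ≈ A
  ≈-refl = record { tree-≡ = refl ; height-≡ = refl ; level-≡ = λ _ → refl }

  ≈-sym : ∀ {n} {A B : IncreasingTree n} → A ≈ B → B ≈ A
  ≈-sym {A = record {}} {B = record {}} record { tree-≡ = refl ; height-≡ = refl ; level-≡ = eq } =
    record { tree-≡ = refl ; height-≡ = refl ; level-≡ = sym ∘ eq }

  ≈-trans : ∀ {n} {A B C : IncreasingTree n} → A ≈ B → B ≈ C → A ≈ C
  ≈-trans {A = record {}} {B = record {}} {C = record {}}
    record { tree-≡ = refl ; height-≡ = refl ; level-≡ = eq }
    record { tree-≡ = refl ; height-≡ = refl ; level-≡ = eq′ } =
    record { tree-≡ = refl ; height-≡ = refl ; level-≡ = λ v → trans (eq v) (eq′ v) }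

theorem1p1 : (n : ℕ) → IsBijection (_≈_ {n}) _≋_ σ
theorem1p1 n = record
  { isInjection = record
    { isCongruent = record
      { cong           = σ-cong
      ; isEquivalence₁ = ≈-isEquivalence
      ; isEquivalence₂ = On.isEquivalence SetComposition.tuple isEquivalence
      }
    ; injective = σ-injective
    }
  ; surjective = λ P → let A , σA≋P = σ-onto P in
      -- Surjectivity is required for every representative `B` of the class of `A`, hence the use of
      -- congruence.
      A , λ {B} B≈A → trans (σ-cong B≈A) σA≋P
  }
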